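{- Let $\Gamma\cup\{\varphi\}$ be a finite set of closed formulas over a basic predicate signature $\Theta$. If $\Gamma\models_{\mathcal T(\mathbf{Tm}^*)}\varphi$ then $\Gamma\models_{\mathbf{Tm}^*}\varphi$.
   Context: Syntax. A basic predicate signature $\Theta$ consists of a nonempty set of predicate symbols, each of arity $\geq1$, and a possibly empty set $C$ of constants (no function symbols, no equality). Terms are variables or constants; formulas: atomic $P\tau_1\ldots\tau_n$, and $\neg\varphi$, $\Box\varphi$, $\forall x\varphi$, $\varphi\to\psi$. $\exists x\varphi$ abbreviates $\neg\forall x\neg\varphi$. $\varphi[x/\tau]$ is substitution of free occurrences of $x$ by $\tau$. Variants $\varphi\sim\psi$: one is obtained from the other by adding/deleting void quantifiers or by renaming bound variables (keeping free variables in the same places). Semantics. Truth values $\{\mathsf T,\mathsf t,\mathsf f,\mathsf F\}$, designated $\{\mathsf T,\mathsf t\}$. $\tilde\neg$: $\mathsf T\mapsto\{\mathsf F\},\mathsf t\mapsto\{\mathsf f\},\mathsf f\mapsto\{\mathsf t\},\mathsf F\mapsto\{\mathsf T\}$. $a\tilde\to b$ (rows $a$, columns $b$ in order $\mathsf T,\mathsf t,\mathsf f,\mathsf F$): row $\mathsf T$: $\{\mathsf T\},\{\mathsf t\},\{\mathsf f\},\{\mathsf F\}$; row $\mathsf t$: $\{\mathsf T\},\{\mathsf T,\mathsf t\},\{\mathsf f\},\{\mathsf f\}$; row $\mathsf f$: $\{\mathsf T\},\{\mathsf T,\mathsf t\},\{\mathsf T,\mathsf t\},\{\mathsf t\}$;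 row $\mathsf F$: all $\{\mathsf T\}$. $\tilde\Box_1\mathsf T=\{\mathsf T,\mathsf t\}$, $\tilde\Box_1a=\{\mathsf f,\mathsf F\}$ for $a\ne\mathsf T$. $\tilde\forall^d_4(X)=\{\min X\}$ for nonempty $X$, order $\mathsf F<\mathsf f<\mathsf t<\mathsf T$. A structure $\mathfrak A=\langle U,\cdot^{\mathfrak A}\rangle$ over $\Theta$: $U\ne\emptyset$, $P^{\mathfrak A}:U^n\to\{\mathsf T,\mathsf t,\mathsf f,\mathsf F\}$, $c^{\mathfrak A}\in U$. $\Theta_U$ adds new constants $\bar a$ for $a\in U\setminus C^{\mathfrak A}$, interpreted by $a$ in $\mathfrak A_U$. A $\mathbf{Tm}^*$-valuation over $\mathfrak A$ is $v:Sen(\Theta_U)\to\{\mathsf T,\mathsf t,\mathsf f,\mathsf F\}$ with $v(Pc_1\ldots c_n)=P^{\mathfrak A}(c_1^{\mathfrak A_U},\ldots,c_n^{\mathfrak A_U})$, $v(\neg\varphi)\in\tilde\neg v(\varphi)$, $v(\Box\varphi)\in\tilde\Box_1v(\varphi)$, $v(\varphi\to\psi)\in v(\varphi)\tilde\to v(\psi)$, $v(\forall x\varphi)\in\tilde\forall^d_4(\{v(\varphi[x/c]):c\in C\cup\bar U\})$, and $v(\varphi)=v(\varphi')$ whenever $\varphi\sim\varphi'$. For formulas with free variables among $x_1,\dots,x_n$, $\Gamma\models_{\mathbf{Tm}^*}\varphi$ iff for every structure $\mathfrak A$ over $\Theta$ and every $\mathbf{Tm}^*$-valuation $v$ over it,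 if $v(\gamma[\vec x/\vec c])\in\{\mathsf T,\mathsf t\}$ for all $\gamma\in\Gamma$ and all $\vec c$ from $C\cup\bar U$, then $v(\varphi[\vec x/\vec c])\in\{\mathsf T,\mathsf t\}$ for all $\vec c$. Tableaux. Let $\bar C=\{c_1,c_2,\ldots\}$ be an infinite set of new constants, $\Theta(\bar C)$ the extended signature. A signed formula is $\mathsf L{:}\varphi$ with $\mathsf L\in\{\mathsf T,\mathsf t,\mathsf f,\mathsf F\}$, $\varphi$ closed over $\Theta(\bar C)$; $\varphi(c)$ means $\varphi[x/c]$. A tableau for a signed formula is a finite tree with that formula at the root, obtained by repeatedly applying a rule to a signed formula on a branch and extending that branch by the alternatives of the rule (separated by $\mid$; each alternative gives a new branch containing the listed signed formulas). Rules: $\mathsf T{:}\neg\varphi/\mathsf F{:}\varphi$; $\mathsf t{:}\neg\varphi/\mathsf f{:}\varphi$; $\mathsf f{:}\neg\varphi/\mathsf t{:}\varphi$; $\mathsf F{:}\neg\varphi/\mathsf T{:}\varphi$; $\mathsf T{:}\Box\varphi/\mathsf T{:}\varphi$; $\mathsf t{:}\Box\varphi/\mathsf T{:}\varphi$; $\mathsf f{:}\Box\varphi/\mathsf t{:}\varphi\mid\mathsf f{:}\varphi\mid\mathsf F{:}\varphi$; $\mathsf F{:}\Box\varphi/\mathsf t{:}\varphi\mid\mathsf f{:}\varphi\mid\mathsf F{:}\varphi$; $\mathsf T{:}(\varphi\to\psi)/\mathsf F{:}\varphi\mid\mathsf t{:}\varphi,\mathsf t{:}\psi\mid\mathsf f{:}\varphi,\mathsf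 t{:}\psi\mid\mathsf f{:}\varphi,\mathsf f{:}\psi\mid\mathsf T{:}\psi$; $\mathsf t{:}(\varphi\to\psi)/\mathsf T{:}\varphi,\mathsf t{:}\psi\mid\mathsf t{:}\varphi,\mathsf t{:}\psi\mid\mathsf f{:}\varphi,\mathsf t{:}\psi\mid\mathsf f{:}\varphi,\mathsf f{:}\psi$; $\mathsf f{:}(\varphi\to\psi)/\mathsf T{:}\varphi,\mathsf f{:}\psi\mid\mathsf t{:}\varphi,\mathsf f{:}\psi\mid\mathsf t{:}\varphi,\mathsf F{:}\psi$; $\mathsf F{:}(\varphi\to\psi)/\mathsf T{:}\varphi,\mathsf F{:}\psi$. Quantifier rules: $(\mathsf T\forall)$ $\mathsf T{:}\forall x\varphi/\mathsf T{:}\varphi(c)$, $c$ any constant, reusable with any constants; $(\mathsf F\forall)$ $\mathsf F{:}\forall x\varphi/\mathsf F{:}\varphi(c)$, $c$ a constant not yet on the branch, usable only once per branch; $(\mathsf t\forall)$ $\mathsf t{:}\forall x\varphi/\mathsf t{:}\varphi(c),\mathsf t{:}\varphi(c')\mid\mathsf t{:}\varphi(c),\mathsf T{:}\varphi(c')$, where $c$ is new on the branch and $c'\neq c$ arbitrary; it is reusable in the sense that afterwards each resulting branch may again be split into a branch with $\mathsf t{:}\varphi(c'')$ and a branch with $\mathsf T{:}\varphi(c''')$ for any $c'',c'''\neq c$; $(\mathsf f\forall)$ $\mathsf f{:}\forall x\varphi/\mathsf f{:}\varphi(c),\mathsf f{:}\varphi(c')\mid\mathsf f{:}\varphi(c),\mathsf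 T{:}\varphi(c')\mid\mathsf f{:}\varphi(c),\mathsf t{:}\varphi(c')$, $c$ new on the branch, $c'\neq c$; reusable in the sense that each resulting branch may be split again into three branches containing $\mathsf f{:}\varphi(c'')$, $\mathsf T{:}\varphi(c''')$, $\mathsf t{:}\varphi(c'''')$ respectively, for any constants different from $c$. A branch is closed if it contains $\mathsf L{:}\varphi$ and $\mathsf L'{:}\varphi'$ with $\varphi\sim\varphi'$ and $\mathsf L\ne\mathsf L'$; a tableau is closed if all its branches are closed. A closed formula $\varphi$ over $\Theta$ is provable, $\models_{\mathcal T(\mathbf{Tm}^*)}\varphi$, if for each $\mathsf L\in\{\mathsf F,\mathsf f\}$ there is a closed tableau starting from $\mathsf L{:}\varphi$. For $\Gamma=\{\gamma_1,\ldots,\gamma_n\}$, $\Gamma\models_{\mathcal T(\mathbf{Tm}^*)}\varphi$ means $\models_{\mathcal T(\mathbf{Tm}^*)}(\gamma_1\to(\gamma_2\to\cdots\to(\gamma_n\to\varphi)\cdots))$.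
   Formalization: The rule for t:(φ→ψ) gets the extra alternative f:φ, F:ψ, and each reuse split of (t∀) and (f∀) uses one and the same constant in all its alternatives; with the rules as printed the calculus is unsound. -}

module Defs where

open import Data.List using (List; []; _∷_; _++_; foldr; map)
open import Data.List.Membership.Propositional using (_∈_)
open import Data.List.Relation.Unary.All using (All; []; _∷_)
open import Data.List.Relation.Unary.Any using (here; there)
open import Data.Nat using (ℕ; _≤_; _≟_)
open import Data.Product using (Σ; ∃; ∃-syntax; _×_; _,_)
open import Data.Refinement using (Refinement; Refinement-syntax; value; _,_)
open import Data.Irrelevant using ([_])
open import Data.Sum using (_⊎_; inj₁; inj₂)
import Data.Sum as Sum
open import Data.Unit using (⊤)
open import Data.Vec using (Vec; []; _∷_)
import Data.Vec as Vec
import Data.Vec.Relation.Unary.Any as VecAny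
open import Data.Vec.Membership.Propositional using () renaming (_∈_ to _∈ᵛ_)
open import Level using (0ℓ)
open import Relation.Binary.PropositionalEquality using (_≡_; _≢_; refl; sym)
open import Relation.Nullary using (¬_; yes; no; contradiction)
open import Relation.Unary using (Pred)

------------------------------------------------------------------------
-- Syntax

record Signature : Set₁ where
  field
    PredSym  : Set
    arity    : PredSym → ℕ
    arity≥1  : ∀ P → 1 ≤ arity P
    somePred : PredSym
    Const    : Set

open Signature public

_⊕_ : Signature → Set → Signature
Θ ⊕ K = record
  { PredSym  = PredSym Θ
  ; arity    = arity Θ
  ; arity≥1  = arity≥1 Θ
  ; somePred = somePred Θ
  ; Const    = Const Θ ⊎ K
  }

Var : Set
Var = ℕ

data Term (Θ : Signature) : Set where
  var : Var → Term Θ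
  con : Const Θ → Term Θ

infixr 20 _⇒_

data Formula (Θ : Signature) : Set where
  atom : (P : PredSym Θ) → Vec (Term Θ) (arity Θ P) → Formula Θ
  neg  : Formula Θ → Formula Θ
  □    : Formula Θ → Formula Θ
  all  : Var → Formula Θ → Formula Θ
  _⇒_  : Formula Θ → Formula Θ → Formula Θ

module _ {Θ : Signature} where

  infix 4 _∈FV_ _occursIn_

  _∈FV_ : Var → Formula Θ → Set
  x ∈FV atom P ts = var x ∈ᵛ ts
  x ∈FV neg φ     = x ∈FV φ
  x ∈FV □ φ       = x ∈FV φ
  x ∈FV all y φ   = x ≢ y × x ∈FV φ
  x ∈FV (φ ⇒ ψ)   = x ∈FV φ ⊎ x ∈FV ψ

  Closed : Formula Θ → Set
  Closed φ = ∀ x → ¬ (x ∈FV φ)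

  _occursIn_ : Const Θ → Formula Θ → Set
  c occursIn atom P ts = con c ∈ᵛ ts
  c occursIn neg φ     = c occursIn φ
  c occursIn □ φ       = c occursIn φ
  c occursIn all y φ   = c occursIn φ
  c occursIn (φ ⇒ ψ)   = c occursIn φ ⊎ c occursIn ψ

  Env : Set
  Env = Var → Term Θ

  _⟨_↦_⟩ : Env → Var → Term Θ → Env
  (e ⟨ x ↦ τ ⟩) y with y ≟ x
  ... | yes _ = τ
  ... | no  _ = e y

  substᵗ : Env → Term Θ → Term Θ
  substᵗ e (var x) = e x
  substᵗ e (con c) = con c

  -- Simultaneous replacement of the free occurrences of variables.  Bound
  -- variables are not renamed, so substituting a variable may capture; see
  -- FreeFor.
  subst : Env → Formula Θ → Formula Θ
  subst e (atom P ts) = atom P (Vec.map (substᵗ e) ts)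
  subst e (neg φ)     = neg (subst e φ)
  subst e (□ φ)       = □ (subst e φ)
  subst e (all x φ)   = all x (subst (e ⟨ x ↦ var x ⟩) φ)
  subst e (φ ⇒ ψ)     = subst e φ ⇒ subst e ψ

  infixl 30 _[_/_]

  _[_/_] : Formula Θ → Var → Term Θ → Formula Θ
  φ [ x / τ ] = subst (var ⟨ x ↦ τ ⟩) φ

  -- No free occurrence of x in φ lies in the scope of a quantifier ∀y.
  FreeFor : (y x : Var) → Formula Θ → Set
  FreeFor y x (atom P ts) = ⊤
  FreeFor y x (neg φ)     = FreeFor y x φ
  FreeFor y x (□ φ)       = FreeFor y x φ
  FreeFor y x (all z φ)   = x ∈FV all z φ → y ≢ z × FreeFor y x φ
  FreeFor y x (φ ⇒ ψ)     = FreeFor y x φ × FreeFor y x ψ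

  infix 4 _∼_

  data _∼_ : Formula Θ → Formula Θ → Set where
    void    : ∀ {x φ} → ¬ (x ∈FV φ) → all x φ ∼ φ
    rename  : ∀ {x y φ} → ¬ (y ∈FV φ) → FreeFor y x φ →
              all x φ ∼ all y (φ [ x / var y ])
    ∼-refl  : ∀ {φ} → φ ∼ φ
    ∼-sym   : ∀ {φ ψ} → φ ∼ ψ → ψ ∼ φ
    ∼-trans : ∀ {φ ψ χ} → φ ∼ ψ → ψ ∼ χ → φ ∼ χ
    ∼-neg   : ∀ {φ φ′} → φ ∼ φ′ → neg φ ∼ neg φ′
    ∼-□     : ∀ {φ φ′} → φ ∼ φ′ → □ φ ∼ □ φ′
    ∼-all   : ∀ {x φ φ′} → φ ∼ φ′ → all x φ ∼ all x φ′
    ∼-⇒     : ∀ {φ φ′ ψ ψ′} → φ ∼ φ′ → ψ ∼ ψ′ → φ ⇒ ψ ∼ φ′ ⇒ ψ′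

  var-∈-subst : ∀ {n y} (e : Env) (ts : Vec (Term Θ) n) →
                var y ∈ᵛ Vec.map (substᵗ e) ts →
                ∃[ x ] var x ∈ᵛ ts × e x ≡ var y
  var-∈-subst e (var x ∷ ts) (VecAny.here p) = x , VecAny.here refl , sym p
  var-∈-subst e (t ∷ ts) (VecAny.there q) with var-∈-subst e ts q
  ... | x , r , p = x , VecAny.there r , p

  FV-subst : ∀ {y} (e : Env) (φ : Formula Θ) → y ∈FV subst e φ →
             ∃[ x ] x ∈FV φ × e x ≡ var y
  FV-subst e (atom P ts) h = var-∈-subst e ts h
  FV-subst e (neg φ) h = FV-subst e φ h
  FV-subst e (□ φ) h = FV-subst e φ h
  FV-subst e (all z φ) (y≢z , h) with FV-subst (e ⟨ z ↦ var z ⟩) φ h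
  ... | x , r , p with x ≟ z | p
  ...   | yes _   | refl = contradiction refl y≢z
  ...   | no  x≢z | q    = x , (x≢z , r) , q
  FV-subst e (φ ⇒ ψ) (inj₁ h) with FV-subst e φ h
  ... | x , r , p = x , inj₁ r , p
  FV-subst e (φ ⇒ ψ) (inj₂ h) with FV-subst e ψ h
  ... | x , r , p = x , inj₂ r , p

  closed-inst : ∀ {x φ} c → Closed (all x φ) → Closed (φ [ x / con c ])
  closed-inst {x} {φ} c cl y h with FV-subst (var ⟨ x ↦ con c ⟩) φ h
  ... | z , r , p with z ≟ x | p
  ...   | no z≢x | refl = cl z (z≢x , r)

  closed-ground : ∀ (ρ : Var → Const Θ) φ → Closed (subst (λ x → con (ρ x)) φ)
  closed-ground ρ φ y h with FV-subst (λ x → con (ρ x)) φ h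
  ... | _ , _ , ()

Sentence : Signature → Set
Sentence Θ = [ φ ∈ Formula Θ ∣ Closed φ ]

liftᵗ : ∀ {Θ K} → Term Θ → Term (Θ ⊕ K)
liftᵗ (var x) = var x
liftᵗ (con c) = con (inj₁ c)

lift : ∀ {Θ K} → Formula Θ → Formula (Θ ⊕ K)
lift (atom P ts) = atom P (Vec.map liftᵗ ts)
lift (neg φ)     = neg (lift φ)
lift (□ φ)       = □ (lift φ)
lift (all x φ)   = all x (lift φ)
lift (φ ⇒ ψ)     = lift φ ⇒ lift ψ

------------------------------------------------------------------------
-- Non-deterministic matrix

data Value : Set where
  𝕋 𝕥 𝕗 𝔽 : Value

rank : Value → ℕ
rank 𝔽 = 0
rank 𝕗 = 1
rank 𝕥 = 2
rank 𝕋 = 3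

infix 4 _≤ᵛ_

_≤ᵛ_ : Value → Value → Set
a ≤ᵛ b = rank a ≤ rank b

designated : List Value
designated = 𝕋 ∷ 𝕥 ∷ []

¬̃ : Value → List Value
¬̃ 𝕋 = 𝔽 ∷ []
¬̃ 𝕥 = 𝕗 ∷ []
¬̃ 𝕗 = 𝕥 ∷ []
¬̃ 𝔽 = 𝕋 ∷ []

□̃₁ : Value → List Value
□̃₁ 𝕋 = 𝕋 ∷ 𝕥 ∷ []
□̃₁ 𝕥 = 𝕗 ∷ 𝔽 ∷ []
□̃₁ 𝕗 = 𝕗 ∷ 𝔽 ∷ []
□̃₁ 𝔽 = 𝕗 ∷ 𝔽 ∷ []

infix 20 _→̃_

_→̃_ : Value → Value → List Value
𝕋 →̃ 𝕋 = 𝕋 ∷ []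
𝕋 →̃ 𝕥 = 𝕥 ∷ []
𝕋 →̃ 𝕗 = 𝕗 ∷ []
𝕋 →̃ 𝔽 = 𝔽 ∷ []
𝕥 →̃ 𝕋 = 𝕋 ∷ []
𝕥 →̃ 𝕥 = 𝕋 ∷ 𝕥 ∷ []
𝕥 →̃ 𝕗 = 𝕗 ∷ []
𝕥 →̃ 𝔽 = 𝕗 ∷ []
𝕗 →̃ 𝕋 = 𝕋 ∷ []
𝕗 →̃ 𝕥 = 𝕋 ∷ 𝕥 ∷ []
𝕗 →̃ 𝕗 = 𝕋 ∷ 𝕥 ∷ []
𝕗 →̃ 𝔽 = 𝕥 ∷ []
𝔽 →̃ 𝕋 = 𝕋 ∷ []
𝔽 →̃ 𝕥 = 𝕋 ∷ []
𝔽 →̃ 𝕗 = 𝕋 ∷ []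
𝔽 →̃ 𝔽 = 𝕋 ∷ []

-- a ∈ {min X}.
∀̃ᵈ₄ : Pred Value 0ℓ → Pred Value 0ℓ
∀̃ᵈ₄ X a = X a × (∀ b → X b → a ≤ᵛ b)

------------------------------------------------------------------------
-- Structures, valuations, consequence

record Structure (Θ : Signature) : Set₁ where
  field
    U      : Set
    point  : U
    predᴬ  : (P : PredSym Θ) → Vec U (arity Θ P) → Value
    constᴬ : Const Θ → U

module _ {Θ : Signature} (𝔄 : Structure Θ) where

  open Structure 𝔄

  -- The new constants ā, for the elements a that no constant of Θ denotes.
  Ū : Set
  Ū = [ a ∈ U ∣ ¬ (∃[ c ] constᴬ c ≡ a) ]

  Θᵁ : Signature
  Θᵁ = Θ ⊕ Ū

  constᵁ : Const Θᵁ → U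
  constᵁ = Sum.[ constᴬ , value ]

  record Valuation : Set where
    field
      v      : Sentence Θᵁ → Value
      v-atom : ∀ P cs .h →
               v (atom P (Vec.map con cs) , [ h ]) ≡ predᴬ P (Vec.map constᵁ cs)
      v-neg  : ∀ φ .h → v (neg φ , [ h ]) ∈ ¬̃ (v (φ , [ h ]))
      v-□    : ∀ φ .h → v (□ φ , [ h ]) ∈ □̃₁ (v (φ , [ h ]))
      v-⇒    : ∀ φ ψ .h → v (φ ⇒ ψ , [ h ]) ∈
               v (φ , [ (λ x p → h x (inj₁ p)) ]) →̃
               v (ψ , [ (λ x p → h x (inj₂ p)) ])
      v-all  : ∀ x φ .h → ∀̃ᵈ₄
               (λ a → ∃[ c ] v (φ [ x / con c ] , [ closed-inst {φ = φ} c h ]) ≡ a)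
               (v (all x φ , [ h ]))
      v-∼    : ∀ φ φ′ .h .h′ → φ ∼ φ′ → v (φ , [ h ]) ≡ v (φ′ , [ h′ ])

  -- φ[x⃗/c⃗], for the tuple c⃗ given by ρ.
  instantiate : Formula Θ → (Var → Const Θᵁ) → Sentence Θᵁ
  instantiate φ ρ = subst (λ x → con (ρ x)) (lift φ) , [ closed-ground ρ (lift φ) ]

infix 4 _⊨_

_⊨_ : ∀ {Θ} → List (Formula Θ) → Formula Θ → Set₁
_⊨_ {Θ} Γ φ = (𝔄 : Structure Θ) (V : Valuation 𝔄) → let open Valuation V in
  (∀ γ → γ ∈ Γ → ∀ ρ → v (instantiate 𝔄 γ ρ) ∈ designated) →
  ∀ ρ → v (instantiate 𝔄 φ ρ) ∈ designated

------------------------------------------------------------------------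
-- Tableaux

-- C̄ = {c₁, c₂, …}
C̄ : Set
C̄ = ℕ

module _ {Θ : Signature} where

  infix 10 _∶_

  -- Closedness of φ need not be recorded: the rules only ever produce closed
  -- formulas from closed ones.
  data SignedFormula : Set where
    _∶_ : Value → Formula (Θ ⊕ C̄) → SignedFormula

  data PropRule : SignedFormula → List (List SignedFormula) → Set where
    T¬ : ∀ {φ} → PropRule (𝕋 ∶ neg φ) ((𝔽 ∶ φ ∷ []) ∷ [])
    t¬ : ∀ {φ} → PropRule (𝕥 ∶ neg φ) ((𝕗 ∶ φ ∷ []) ∷ [])
    f¬ : ∀ {φ} → PropRule (𝕗 ∶ neg φ) ((𝕥 ∶ φ ∷ []) ∷ [])
    F¬ : ∀ {φ} → PropRule (𝔽 ∶ neg φ) ((𝕋 ∶ φ ∷ []) ∷ [])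
    T□ : ∀ {φ} → PropRule (𝕋 ∶ □ φ) ((𝕋 ∶ φ ∷ []) ∷ [])
    t□ : ∀ {φ} → PropRule (𝕥 ∶ □ φ) ((𝕋 ∶ φ ∷ []) ∷ [])
    f□ : ∀ {φ} → PropRule (𝕗 ∶ □ φ)
         ((𝕥 ∶ φ ∷ []) ∷ (𝕗 ∶ φ ∷ []) ∷ (𝔽 ∶ φ ∷ []) ∷ [])
    F□ : ∀ {φ} → PropRule (𝔽 ∶ □ φ)
         ((𝕥 ∶ φ ∷ []) ∷ (𝕗 ∶ φ ∷ []) ∷ (𝔽 ∶ φ ∷ []) ∷ [])
    T⇒ : ∀ {φ ψ} → PropRule (𝕋 ∶ φ ⇒ ψ)
         ( (𝔽 ∶ φ ∷ [])
         ∷ (𝕥 ∶ φ ∷ 𝕥 ∶ ψ ∷ [])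
         ∷ (𝕗 ∶ φ ∷ 𝕥 ∶ ψ ∷ [])
         ∷ (𝕗 ∶ φ ∷ 𝕗 ∶ ψ ∷ [])
         ∷ (𝕋 ∶ ψ ∷ [])
         ∷ [])
    -- The last alternative corresponds to 𝕗 →̃ 𝔽 = {𝕥}.  It is missing from the
    -- source's list of rules; without it the calculus is unsound.
    t⇒ : ∀ {φ ψ} → PropRule (𝕥 ∶ φ ⇒ ψ)
         ( (𝕋 ∶ φ ∷ 𝕥 ∶ ψ ∷ [])
         ∷ (𝕥 ∶ φ ∷ 𝕥 ∶ ψ ∷ [])
         ∷ (𝕗 ∶ φ ∷ 𝕥 ∶ ψ ∷ [])
         ∷ (𝕗 ∶ φ ∷ 𝕗 ∶ ψ ∷ [])
         ∷ (𝕗 ∶ φ ∷ 𝔽 ∶ ψ ∷ [])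
         ∷ [])
    f⇒ : ∀ {φ ψ} → PropRule (𝕗 ∶ φ ⇒ ψ)
         ( (𝕋 ∶ φ ∷ 𝕗 ∶ ψ ∷ [])
         ∷ (𝕥 ∶ φ ∷ 𝕗 ∶ ψ ∷ [])
         ∷ (𝕥 ∶ φ ∷ 𝔽 ∶ ψ ∷ [])
         ∷ [])
    F⇒ : ∀ {φ ψ} → PropRule (𝔽 ∶ φ ⇒ ψ) ((𝕋 ∶ φ ∷ 𝔽 ∶ ψ ∷ []) ∷ [])

  -- Besides its signed formulas, a branch records which of them the rules
  -- F∀, t∀ and f∀ have been applied to, and the new constant then chosen.
  record Branch : Set where
    constructor mkBranch
    field
      formulas  : List SignedFormula
      witnesses : List (SignedFormula × Const (Θ ⊕ C̄))

  open Branch public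

  infixl 5 _◂_

  _◂_ : Branch → List SignedFormula → Branch
  B ◂ Δ = mkBranch (Δ ++ formulas B) (witnesses B)

  witnessed : Branch → SignedFormula → Const (Θ ⊕ C̄) → Branch
  witnessed B σ c = mkBranch (formulas B) ((σ , c) ∷ witnesses B)

  Unused : SignedFormula → Branch → Set
  Unused σ B = ¬ (∃[ c ] (σ , c) ∈ witnesses B)

  _newOn_ : Const (Θ ⊕ C̄) → Branch → Set
  c newOn B = ∀ L φ → L ∶ φ ∈ formulas B → ¬ (c occursIn φ)

  infix 4 _⟶_

  -- B ⟶ Bs: one rule application turns the branch B into the branches Bs.
  data _⟶_ (B : Branch) : List Branch → Set where
    prop : ∀ {σ Δs} → σ ∈ formulas B → PropRule σ Δs → B ⟶ map (B ◂_) Δs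

    T∀ : ∀ {x φ} c → 𝕋 ∶ all x φ ∈ formulas B →
         B ⟶ (B ◂ (𝕋 ∶ φ [ x / con c ] ∷ [])) ∷ []

    F∀ : ∀ {x φ} c → let σ = 𝔽 ∶ all x φ in
         σ ∈ formulas B → Unused σ B → c newOn B →
         B ⟶ (witnessed B σ c ◂ (𝔽 ∶ φ [ x / con c ] ∷ [])) ∷ []

    t∀ : ∀ {x φ} c c′ → let σ = 𝕥 ∶ all x φ ; B′ = witnessed B σ c in
         σ ∈ formulas B → Unused σ B → c newOn B → c′ ≢ c →
         B ⟶ (B′ ◂ (𝕥 ∶ φ [ x / con c ] ∷ 𝕥 ∶ φ [ x / con c′ ] ∷ []))
           ∷ (B′ ◂ (𝕥 ∶ φ [ x / con c ] ∷ 𝕋 ∶ φ [ x / con c′ ] ∷ []))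
           ∷ []

    -- Reuse of t∀ and f∀: one constant c′ for all alternatives of a split, as
    -- in the initial application.  With a different constant in each
    -- alternative the split would not be exhaustive.
    t∀-again : ∀ {x φ} c c′ → (𝕥 ∶ all x φ , c) ∈ witnesses B → c′ ≢ c →
         B ⟶ (B ◂ (𝕥 ∶ φ [ x / con c′ ] ∷ []))
           ∷ (B ◂ (𝕋 ∶ φ [ x / con c′ ] ∷ []))
           ∷ []

    f∀ : ∀ {x φ} c c′ → let σ = 𝕗 ∶ all x φ ; B′ = witnessed B σ c in
         σ ∈ formulas B → Unused σ B → c newOn B → c′ ≢ c →
         B ⟶ (B′ ◂ (𝕗 ∶ φ [ x / con c ] ∷ 𝕗 ∶ φ [ x / con c′ ] ∷ []))
           ∷ (B′ ◂ (𝕗 ∶ φ [ x / con c ] ∷ 𝕋 ∶ φ [ x / con c′ ] ∷ []))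
           ∷ (B′ ◂ (𝕗 ∶ φ [ x / con c ] ∷ 𝕥 ∶ φ [ x / con c′ ] ∷ []))
           ∷ []

    f∀-again : ∀ {x φ} c c′ → (𝕗 ∶ all x φ , c) ∈ witnesses B → c′ ≢ c →
         B ⟶ (B ◂ (𝕗 ∶ φ [ x / con c′ ] ∷ []))
           ∷ (B ◂ (𝕋 ∶ φ [ x / con c′ ] ∷ []))
           ∷ (B ◂ (𝕥 ∶ φ [ x / con c′ ] ∷ []))
           ∷ []

  -- The part of a tableau below the branch B built so far.
  data Tableau (B : Branch) : Set where
    leaf   : Tableau B
    extend : ∀ {Bs} → B ⟶ Bs → All Tableau Bs → Tableau B

  branches  : ∀ {B} → Tableau B → List Branch
  branchesˢ : ∀ {Bs} → All Tableau Bs → List Branch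
  branches {B} leaf      = B ∷ []
  branches (extend _ ts) = branchesˢ ts
  branchesˢ []           = []
  branchesˢ (t ∷ ts)     = branches t ++ branchesˢ ts

  ClosedBranch : Branch → Set
  ClosedBranch B = ∃[ L ] ∃[ L′ ] ∃[ φ ] ∃[ φ′ ]
    L ∶ φ ∈ formulas B × L′ ∶ φ′ ∈ formulas B × φ ∼ φ′ × L ≢ L′

  ClosedTableau : ∀ {B} → Tableau B → Set
  ClosedTableau t = All ClosedBranch (branches t)

  TableauFor : SignedFormula → Set
  TableauFor σ = Tableau (mkBranch (σ ∷ []) [])

Provable : ∀ {Θ} → Formula Θ → Set
Provable {Θ} φ = ∀ L → L ∈ 𝔽 ∷ 𝕗 ∷ [] →
  Σ (TableauFor {Θ} (L ∶ lift φ)) ClosedTableau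

infix 4 _⊢_

_⊢_ : ∀ {Θ} → List (Formula Θ) → Formula Θ → Set
Γ ⊢ φ = Provable (foldr _⇒_ φ Γ)

{-# OPTIONS --safe #-}

-- A branch is satisfiable if its constants can be interpreted by constants of
-- Θᵁ in such a way that the valuation takes the indicated values.  Each rule
-- turns a satisfiable branch into branches one of which is satisfiable: the new
-- constant of F∀, t∀ or f∀ is reinterpreted as one at which the minimum is
-- attained.  A closed branch is not satisfiable.
--
-- A new constant may belong to Θ, where equality is not decidable, so it cannot
-- be reinterpreted by updating a function.  Interpretations are therefore
-- functional relations that are total up to double negation.
module Submission where

open import Data.Irrelevant using ([_])
open import Data.List using (List; []; _∷_; foldr)
open import Data.List.Membership.Propositional using (_∈_)
open import Data.List.Membership.Propositional.Properties using (∈-++⁺ʳ)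
open import Data.List.Relation.Unary.All as All using (All; []; _∷_)
open import Data.List.Relation.Unary.All.Properties using (++⁺; ++⁻ˡ; ++⁻ʳ)
open import Data.List.Relation.Unary.Any as Any using (Any; here; there)
open import Data.List.Relation.Unary.Any.Properties using (map⁺)
open import Data.Nat using (_≟_; s≤s)
open import Data.Product using (∃; ∃-syntax; Σ-syntax; _×_; _,_; proj₂)
open import Data.Refinement using (value; _,_)
open import Data.Sum as Sum using (_⊎_; inj₁; inj₂)
open import Data.Vec using (Vec; []; _∷_)
import Data.Vec as Vec
import Data.Vec.Relation.Unary.Any as VecAny
open import Data.Vec.Membership.Propositional using () renaming (_∈_ to _∈ᵛ_)
open import Data.Vec.Relation.Binary.Pointwise.Inductive using (Pointwise; []; _∷_)
open import Function using (case_of_)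
open import Relation.Binary.PropositionalEquality
  using (_≡_; _≢_; refl; sym; trans; cong; cong₂) renaming (subst to ≡-subst)
open import Relation.Nullary using (¬_; yes; no; contradiction)
open import Relation.Nullary.Decidable using (¬¬-excluded-middle)
open import Relation.Nullary.Negation using (¬¬-map)
open import Defs

-- Substitution and lifting

module _ {Θ : Signature} where

  substᵗ-id : ∀ {n} (e : Env) (ts : Vec (Term Θ) n) →
              (∀ x → var x ∈ᵛ ts → e x ≡ var x) → Vec.map (substᵗ e) ts ≡ ts
  substᵗ-id e []           h = refl
  substᵗ-id e (var x ∷ ts) h =
    cong₂ _∷_ (h x (VecAny.here refl)) (substᵗ-id e ts (λ y p → h y (VecAny.there p)))
  substᵗ-id e (con c ∷ ts) h =
    cong (con c ∷_) (substᵗ-id e ts (λ y p → h y (VecAny.there p)))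

  subst-id : ∀ (e : Env) (φ : Formula Θ) → (∀ x → x ∈FV φ → e x ≡ var x) →
             subst e φ ≡ φ
  subst-id e (atom P ts) h = cong (atom P) (substᵗ-id e ts h)
  subst-id e (neg φ)     h = cong neg (subst-id e φ h)
  subst-id e (□ φ)       h = cong □ (subst-id e φ h)
  subst-id e (all x φ)   h = cong (all x) (subst-id (e ⟨ x ↦ var x ⟩) φ h′)
    where
    h′ : ∀ y → y ∈FV φ → (e ⟨ x ↦ var x ⟩) y ≡ var y
    h′ y p with y ≟ x
    ... | yes refl = refl
    ... | no  y≢x  = h y (y≢x , p)
  subst-id e (φ ⇒ ψ) h =
    cong₂ _⇒_ (subst-id e φ (λ x p → h x (inj₁ p))) (subst-id e ψ (λ x p → h x (inj₂ p)))

  module _ {K : Set} where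

    var-∈-lift : ∀ {n x} (ts : Vec (Term Θ) n) →
                 var x ∈ᵛ Vec.map (liftᵗ {Θ} {K}) ts → var x ∈ᵛ ts
    var-∈-lift (var x ∷ ts) (VecAny.here refl) = VecAny.here refl
    var-∈-lift (t ∷ ts)     (VecAny.there p)   = VecAny.there (var-∈-lift ts p)

    FV-lift : ∀ {x} (φ : Formula Θ) → x ∈FV lift {Θ} {K} φ → x ∈FV φ
    FV-lift (atom P ts) p         = var-∈-lift ts p
    FV-lift (neg φ)     p         = FV-lift φ p
    FV-lift (□ φ)       p         = FV-lift φ p
    FV-lift (all y φ)   (x≢y , p) = x≢y , FV-lift φ p
    FV-lift (φ ⇒ ψ)     (inj₁ p)  = inj₁ (FV-lift φ p)
    FV-lift (φ ⇒ ψ)     (inj₂ p)  = inj₂ (FV-lift ψ p)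

    closed-lift : ∀ (φ : Formula Θ) → Closed φ → Closed (lift {Θ} {K} φ)
    closed-lift φ h x p = h x (FV-lift φ p)

closed-foldr : ∀ {Θ} (Γ : List (Formula Θ)) φ → All Closed Γ → Closed φ →
               Closed (foldr _⇒_ φ Γ)
closed-foldr []      φ []       h x p        = h x p
closed-foldr (γ ∷ Γ) φ (k ∷ ks) h x (inj₁ p) = k x p
closed-foldr (γ ∷ Γ) φ (k ∷ ks) h x (inj₂ p) = closed-foldr Γ φ ks h x p

-- Replacement of constants along a relation

module ConstantReplacement (Θ : Signature) (K K′ : Set) where

  private
    Θ₁ = Θ ⊕ K
    Θ₂ = Θ ⊕ K′

  ConstRel : Set₁
  ConstRel = Const Θ₁ → Const Θ₂ → Set

  data Relatedᵗ (R : ConstRel) : Term Θ₁ → Term Θ₂ → Set where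
    var : ∀ x → Relatedᵗ R (var x) (var x)
    con : ∀ {c d} → R c d → Relatedᵗ R (con c) (con d)

  -- A relation on syntax trees instead of a map, because a constant has an image only up to double
  -- negation. Variables and binders are left alone, so neither capture nor free variables change.
  data Related (R : ConstRel) : Formula Θ₁ → Formula Θ₂ → Set where
    atom : ∀ P {ts us} → Pointwise (Relatedᵗ R) ts us → Related R (atom P ts) (atom P us)
    neg  : ∀ {φ ψ} → Related R φ ψ → Related R (neg φ) (neg ψ)
    □    : ∀ {φ ψ} → Related R φ ψ → Related R (□ φ) (□ ψ)
    all  : ∀ x {φ ψ} → Related R φ ψ → Related R (all x φ) (all x ψ)
    _⇒_  : ∀ {φ φ′ ψ ψ′} → Related R φ φ′ → Related R ψ ψ′ →
           Related R (φ ⇒ ψ) (φ′ ⇒ ψ′)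

  Functional : ConstRel → Set
  Functional R = ∀ {c d d′} → R c d → R c d′ → d ≡ d′

  ¬¬Total : ConstRel → Set
  ¬¬Total R = ∀ c → ¬ ¬ (∃[ d ] R c d)

  module _ {R : ConstRel} where

    module _ (fun : Functional R) where

      Relatedᵗ-functional : ∀ {t u u′} → Relatedᵗ R t u → Relatedᵗ R t u′ → u ≡ u′
      Relatedᵗ-functional (var x) (var x) = refl
      Relatedᵗ-functional (con r) (con s) = cong con (fun r s)

      Pointwise-functional : ∀ {n} {ts : Vec (Term Θ₁) n} {us us′ : Vec (Term Θ₂) n} →
        Pointwise (Relatedᵗ R) ts us → Pointwise (Relatedᵗ R) ts us′ → us ≡ us′
      Pointwise-functional []       []       = refl
      Pointwise-functional (r ∷ rs) (s ∷ ss) =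
        cong₂ _∷_ (Relatedᵗ-functional r s) (Pointwise-functional rs ss)

      Related-functional : ∀ {φ ψ ψ′} → Related R φ ψ → Related R φ ψ′ → ψ ≡ ψ′
      Related-functional (atom P r) (atom .P s) = cong (atom P) (Pointwise-functional r s)
      Related-functional (neg r)    (neg s)     = cong neg (Related-functional r s)
      Related-functional (□ r)      (□ s)       = cong □ (Related-functional r s)
      Related-functional (all x r)  (all .x s)  = cong (all x) (Related-functional r s)
      Related-functional (r ⇒ r′)   (s ⇒ s′)    =
        cong₂ _⇒_ (Related-functional r s) (Related-functional r′ s′)

    module _ (total : ¬¬Total R) where

      Relatedᵗ-total : ∀ t → ¬ ¬ (∃[ u ] Relatedᵗ R t u)
      Relatedᵗ-total (var x) k = k (var x , var x)
      Relatedᵗ-total (con c) k = total c λ (d , r) → k (con d , con r)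

      Pointwise-total : ∀ {n} (ts : Vec (Term Θ₁) n) →
                        ¬ ¬ (Σ[ us ∈ Vec (Term Θ₂) n ] Pointwise (Relatedᵗ R) ts us)
      Pointwise-total []       k = k ([] , [])
      Pointwise-total (t ∷ ts) k =
        Relatedᵗ-total t λ (u , r) → Pointwise-total ts λ (us , rs) → k (u ∷ us , r ∷ rs)

      -- A formula contains finitely many constants, so the double negations from `total` can be
      -- discharged one after another inside the continuation.
      Related-total : ∀ φ → ¬ ¬ (∃[ ψ ] Related R φ ψ)
      Related-total (atom P ts) = ¬¬-map (λ (_ , r) → _ , atom P r) (Pointwise-total ts)
      Related-total (neg φ)     = ¬¬-map (λ (_ , r) → _ , neg r) (Related-total φ)
      Related-total (□ φ)       = ¬¬-map (λ (_ , r) → _ , □ r) (Related-total φ)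
      Related-total (all x φ)   = ¬¬-map (λ (_ , r) → _ , all x r) (Related-total φ)
      Related-total (φ ⇒ ψ) k   =
        Related-total φ λ (_ , r) → Related-total ψ λ (_ , s) → k (_ , r ⇒ s)

    Relatedᵉ : (Var → Term Θ₁) → (Var → Term Θ₂) → Set
    Relatedᵉ e f = ∀ x → Relatedᵗ R (e x) (f x)

    Relatedᵉ-update : ∀ {e f t u} x → Relatedᵉ e f → Relatedᵗ R t u →
                      Relatedᵉ (e ⟨ x ↦ t ⟩) (f ⟨ x ↦ u ⟩)
    Relatedᵉ-update x r s y with y ≟ x
    ... | yes _ = s
    ... | no  _ = r y

    Pointwise-subst : ∀ {e f} {n} {ts : Vec (Term Θ₁) n} {us : Vec (Term Θ₂) n} →
      Relatedᵉ e f → Pointwise (Relatedᵗ R) ts us →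
      Pointwise (Relatedᵗ R) (Vec.map (substᵗ e) ts) (Vec.map (substᵗ f) us)
    Pointwise-subst r []            = []
    Pointwise-subst r (var x ∷ ss)  = r x ∷ Pointwise-subst r ss
    Pointwise-subst r (con s ∷ ss)  = con s ∷ Pointwise-subst r ss

    Related-subst : ∀ {e f φ ψ} → Relatedᵉ e f → Related R φ ψ →
                    Related R (subst e φ) (subst f ψ)
    Related-subst r (atom P s) = atom P (Pointwise-subst r s)
    Related-subst r (neg s)    = neg (Related-subst r s)
    Related-subst r (□ s)      = □ (Related-subst r s)
    Related-subst r (all x s)  =
      all x (Related-subst (Relatedᵉ-update x r (var x)) s)
    Related-subst r (s ⇒ s′)   = Related-subst r s ⇒ Related-subst r s′

    Related-[/] : ∀ {φ ψ t u} x → Related R φ ψ → Relatedᵗ R t u →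
                  Related R (φ [ x / t ]) (ψ [ x / u ])
    Related-[/] x r s = Related-subst (Relatedᵉ-update x var s) r

    var-∈-Related : ∀ {n x} {ts : Vec (Term Θ₁) n} {us : Vec (Term Θ₂) n} →
      Pointwise (Relatedᵗ R) ts us → var x ∈ᵛ us → var x ∈ᵛ ts
    var-∈-Related (var x ∷ rs) (VecAny.here refl) = VecAny.here refl
    var-∈-Related (_ ∷ rs)     (VecAny.there p)   = VecAny.there (var-∈-Related rs p)

    FV-Related : ∀ {x φ ψ} → Related R φ ψ → x ∈FV ψ → x ∈FV φ
    FV-Related (atom P r) p         = var-∈-Related r p
    FV-Related (neg r)    p         = FV-Related r p
    FV-Related (□ r)      p         = FV-Related r p
    FV-Related (all y r)  (x≢y , p) = x≢y , FV-Related r p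
    FV-Related (r ⇒ s)    (inj₁ p)  = inj₁ (FV-Related r p)
    FV-Related (r ⇒ s)    (inj₂ p)  = inj₂ (FV-Related s p)

    FreeFor-Related : ∀ {x y φ ψ} → Related R φ ψ → FreeFor y x φ → FreeFor y x ψ
    FreeFor-Related (atom P r) h = h
    FreeFor-Related (neg r)    h = FreeFor-Related r h
    FreeFor-Related (□ r)      h = FreeFor-Related r h
    -- The premise of `FreeFor` at a quantifier is contravariant, so the free occurrence is carried
    -- back from the image to the source.
    FreeFor-Related (all z r)  h = λ (x≢z , p) →
      let y≢z , h′ = h (x≢z , FV-Related r p) in y≢z , FreeFor-Related r h′
    FreeFor-Related (r ⇒ s)    (h , k) = FreeFor-Related r h , FreeFor-Related s k

    -- The derivation of variance is replayed on the images. Functionality identifies the given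
    -- image with the one built by the replay; totality provides an image for the middle formula of
    -- `∼-trans`, which is where the double negation comes from.
    Related-∼ : Functional R → ¬¬Total R → ∀ {φ φ′ ψ ψ′} → φ ∼ ψ →
                Related R φ φ′ → Related R ψ ψ′ → ¬ ¬ (φ′ ∼ ψ′)
    Related-∼ fun total (void x∉φ) (all x r) s k with Related-functional fun r s
    ... | refl = k (void λ p → x∉φ (FV-Related r p))
    Related-∼ fun total (rename {x} {y} y∉φ free) (all x r) (all y s) k
      with Related-functional fun (Related-[/] x r (var y)) s
    ... | refl = k (rename (λ p → y∉φ (FV-Related r p)) (FreeFor-Related r free))
    Related-∼ fun total ∼-refl r s k with Related-functional fun r s
    ... | refl = k ∼-refl
    Related-∼ fun total (∼-sym p) r s = ¬¬-map ∼-sym (Related-∼ fun total p s r)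
    Related-∼ fun total (∼-trans {ψ = ψ} p q) r s k =
      Related-total total ψ λ (_ , t) →
      Related-∼ fun total p r t λ p′ →
      Related-∼ fun total q t s λ q′ → k (∼-trans p′ q′)
    Related-∼ fun total (∼-neg p) (neg r) (neg s) = ¬¬-map ∼-neg (Related-∼ fun total p r s)
    Related-∼ fun total (∼-□ p) (□ r) (□ s) = ¬¬-map ∼-□ (Related-∼ fun total p r s)
    Related-∼ fun total (∼-all p) (all x r) (all .x s) =
      ¬¬-map ∼-all (Related-∼ fun total p r s)
    Related-∼ fun total (∼-⇒ p q) (r ⇒ r′) (s ⇒ s′) k =
      Related-∼ fun total p r s λ p′ →
      Related-∼ fun total q r′ s′ λ q′ → k (∼-⇒ p′ q′)

  module _ (R : ConstRel) (lifts : ∀ c → R (inj₁ c) (inj₁ c)) where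

    Pointwise-lift : ∀ {n} (ts : Vec (Term Θ) n) →
      Pointwise (Relatedᵗ R) (Vec.map liftᵗ ts) (Vec.map liftᵗ ts)
    Pointwise-lift []           = []
    Pointwise-lift (var x ∷ ts) = var x ∷ Pointwise-lift ts
    Pointwise-lift (con c ∷ ts) = con (lifts c) ∷ Pointwise-lift ts

    Related-lift : ∀ φ → Related R (lift φ) (lift φ)
    Related-lift (atom P ts) = atom P (Pointwise-lift ts)
    Related-lift (neg φ)     = neg (Related-lift φ)
    Related-lift (□ φ)       = □ (Related-lift φ)
    Related-lift (all x φ)   = all x (Related-lift φ)
    Related-lift (φ ⇒ ψ)     = Related-lift φ ⇒ Related-lift ψ

  -- Reinterpreting one constant

  _⟪_≔_⟫ : ConstRel → Const Θ₁ → Const Θ₂ → ConstRel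
  (R ⟪ c ≔ a ⟫) d b = (d ≡ c × b ≡ a) ⊎ (d ≢ c × R d b)

  update-functional : ∀ {R c a} → Functional R → Functional (R ⟪ c ≔ a ⟫)
  update-functional fun (inj₁ (_ , refl)) (inj₁ (_ , refl)) = refl
  update-functional fun (inj₁ (p , _))    (inj₂ (¬p , _))   = contradiction p ¬p
  update-functional fun (inj₂ (¬p , _))   (inj₁ (p , _))    = contradiction p ¬p
  update-functional fun (inj₂ (_ , r))    (inj₂ (_ , s))    = fun r s

  -- Which disjunct serves `d` depends on whether `d ≡ c`; excluded middle is available here because
  -- the goal is doubly negated.
  update-total : ∀ {R c a} → ¬¬Total R → ¬¬Total (R ⟪ c ≔ a ⟫)
  update-total total d k = ¬¬-excluded-middle λ where
    (yes p) → k (_ , inj₁ (p , refl))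
    (no ¬p) → total d λ (b , r) → k (b , inj₂ (¬p , r))

  -- Freshness makes every constant that occurs distinct from `c`, so each pair survives through the
  -- second disjunct.
  Pointwise-update : ∀ {R c a n} {ts : Vec (Term Θ₁) n} {us : Vec (Term Θ₂) n} →
    ¬ (con c ∈ᵛ ts) → Pointwise (Relatedᵗ R) ts us →
    Pointwise (Relatedᵗ (R ⟪ c ≔ a ⟫)) ts us
  Pointwise-update new []           = []
  Pointwise-update new (var x ∷ rs) =
    var x ∷ Pointwise-update (λ p → new (VecAny.there p)) rs
  Pointwise-update new (con r ∷ rs) =
    con (inj₂ ((λ { refl → new (VecAny.here refl) }) , r)) ∷
    Pointwise-update (λ p → new (VecAny.there p)) rs

  Related-update : ∀ {R c a φ ψ} → ¬ (c occursIn φ) → Related R φ ψ →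
                   Related (R ⟪ c ≔ a ⟫) φ ψ
  Related-update new (atom P r) = atom P (Pointwise-update new r)
  Related-update new (neg r)    = neg (Related-update new r)
  Related-update new (□ r)      = □ (Related-update new r)
  Related-update new (all x r)  = all x (Related-update new r)
  Related-update new (r ⇒ s)    =
    Related-update (λ p → new (inj₁ p)) r ⇒ Related-update (λ p → new (inj₂ p)) s

-- Soundness of the rules

-- An arbitrary instance of a universal formula is only known to lie above the minimum. The values
-- found here and in the next two lemmas match, in order, the alternatives of `T∀`, `t∀` and `f∀`.
≥𝕋 : ∀ a → 𝕋 ≤ᵛ a → a ≡ 𝕋
≥𝕋 𝕋 _ = refl
≥𝕋 𝕥 (s≤s (s≤s ()))
≥𝕋 𝕗 (s≤s ())
≥𝕋 𝔽 ()

≥𝕥 : ∀ a → 𝕥 ≤ᵛ a → a ≡ 𝕥 ⊎ a ≡ 𝕋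
≥𝕥 𝕋 _ = inj₂ refl
≥𝕥 𝕥 _ = inj₁ refl
≥𝕥 𝕗 (s≤s ())
≥𝕥 𝔽 ()

≥𝕗 : ∀ a → 𝕗 ≤ᵛ a → a ≡ 𝕗 ⊎ a ≡ 𝕋 ⊎ a ≡ 𝕥
≥𝕗 𝕋 _ = inj₂ (inj₁ refl)
≥𝕗 𝕥 _ = inj₂ (inj₂ refl)
≥𝕗 𝕗 _ = inj₁ refl
≥𝕗 𝔽 ()

-- Only two rows and two columns of the table matter. This is modus ponens in contraposed form.
→̃-undesignated : ∀ a b {d} → a ∈ designated → b ∈ 𝔽 ∷ 𝕗 ∷ [] → d ∈ a →̃ b →
                 d ∈ 𝔽 ∷ 𝕗 ∷ []
→̃-undesignated 𝕋 𝔽 _ _ (here p) = here p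
→̃-undesignated 𝕋 𝕗 _ _ (here p) = there (here p)
→̃-undesignated 𝕥 𝔽 _ _ (here p) = there (here p)
→̃-undesignated 𝕥 𝕗 _ _ (here p) = there (here p)
→̃-undesignated 𝕗 _ (there (there ()))
→̃-undesignated 𝔽 _ (there (there ()))
→̃-undesignated _ 𝕋 _ (there (there ()))
→̃-undesignated _ 𝕥 _ (there (there ()))

designated-or-not : ∀ a → a ∈ designated ⊎ a ∈ 𝔽 ∷ 𝕗 ∷ []
designated-or-not 𝕋 = inj₁ (here refl)
designated-or-not 𝕥 = inj₁ (there (here refl))
designated-or-not 𝕗 = inj₂ (there (here refl))
designated-or-not 𝔽 = inj₂ (here refl)

-- Exhaustiveness of the propositional rules

module _ {Θ : Signature} {P : SignedFormula {Θ} → Set} where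

  neg-alternatives : ∀ a {L φ Δs} → P (a ∶ φ) → L ∈ ¬̃ a → PropRule (L ∶ neg φ) Δs →
                     Any (All P) Δs
  neg-alternatives 𝔽 p (here refl) T¬ = here (p ∷ [])
  neg-alternatives 𝕗 p (here refl) t¬ = here (p ∷ [])
  neg-alternatives 𝕥 p (here refl) f¬ = here (p ∷ [])
  neg-alternatives 𝕋 p (here refl) F¬ = here (p ∷ [])

  □-alternatives : ∀ a {L φ Δs} → P (a ∶ φ) → L ∈ □̃₁ a → PropRule (L ∶ □ φ) Δs →
                   Any (All P) Δs
  □-alternatives 𝕋 p (here refl)         T□ = here (p ∷ [])
  □-alternatives 𝕋 p (there (here refl)) t□ = here (p ∷ [])
  □-alternatives 𝕥 p (here refl)         f□ = here (p ∷ [])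
  □-alternatives 𝕥 p (there (here refl)) F□ = here (p ∷ [])
  □-alternatives 𝕗 p (here refl)         f□ = there (here (p ∷ []))
  □-alternatives 𝕗 p (there (here refl)) F□ = there (here (p ∷ []))
  □-alternatives 𝔽 p (here refl)         f□ = there (there (here (p ∷ [])))
  □-alternatives 𝔽 p (there (here refl)) F□ = there (there (here (p ∷ [])))

  -- The table read backwards: the alternatives for `L` cover exactly the pairs whose entry contains
  -- `L`. For `T⇒`, row `𝔽` and column `𝕋` are each covered by a single alternative.
  ⇒-alternatives : ∀ a b {L φ ψ Δs} → P (a ∶ φ) → P (b ∶ ψ) → L ∈ a →̃ b →
                   PropRule (L ∶ φ ⇒ ψ) Δs → Any (All P) Δs
  ⇒-alternatives 𝕋 𝕋 p q (here refl)         T⇒ = there (there (there (there (here (q ∷ [])))))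
  ⇒-alternatives 𝕋 𝕥 p q (here refl)         t⇒ = here (p ∷ q ∷ [])
  ⇒-alternatives 𝕋 𝕗 p q (here refl)         f⇒ = here (p ∷ q ∷ [])
  ⇒-alternatives 𝕋 𝔽 p q (here refl)         F⇒ = here (p ∷ q ∷ [])
  ⇒-alternatives 𝕥 𝕋 p q (here refl)         T⇒ = there (there (there (there (here (q ∷ [])))))
  ⇒-alternatives 𝕥 𝕥 p q (here refl)         T⇒ = there (here (p ∷ q ∷ []))
  ⇒-alternatives 𝕥 𝕥 p q (there (here refl)) t⇒ = there (here (p ∷ q ∷ []))
  ⇒-alternatives 𝕥 𝕗 p q (here refl)         f⇒ = there (here (p ∷ q ∷ []))
  ⇒-alternatives 𝕥 𝔽 p q (here refl)         f⇒ = there (there (here (p ∷ q ∷ [])))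
  ⇒-alternatives 𝕗 𝕋 p q (here refl)         T⇒ = there (there (there (there (here (q ∷ [])))))
  ⇒-alternatives 𝕗 𝕥 p q (here refl)         T⇒ = there (there (here (p ∷ q ∷ [])))
  ⇒-alternatives 𝕗 𝕥 p q (there (here refl)) t⇒ = there (there (here (p ∷ q ∷ [])))
  ⇒-alternatives 𝕗 𝕗 p q (here refl)         T⇒ = there (there (there (here (p ∷ q ∷ []))))
  ⇒-alternatives 𝕗 𝕗 p q (there (here refl)) t⇒ = there (there (there (here (p ∷ q ∷ []))))
  ⇒-alternatives 𝕗 𝔽 p q (here refl)         t⇒ = there (there (there (there (here (p ∷ q ∷ [])))))
  ⇒-alternatives 𝔽 𝕋 p q (here refl)         T⇒ = here (p ∷ [])
  ⇒-alternatives 𝔽 𝕥 p q (here refl)         T⇒ = here (p ∷ [])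
  ⇒-alternatives 𝔽 𝕗 p q (here refl)         T⇒ = here (p ∷ [])
  ⇒-alternatives 𝔽 𝔽 p q (here refl)         T⇒ = here (p ∷ [])

-- Signed formulas under a fixed valuation

module _ {Θ : Signature} {𝔄 : Structure Θ} (V : Valuation 𝔄) where

  open Valuation V
  open ConstantReplacement Θ C̄ (Ū 𝔄)

  v-cong : ∀ {φ ψ : Formula (Θᵁ 𝔄)} .{h : Closed φ} .{k : Closed ψ} → φ ≡ ψ →
           v (φ , [ h ]) ≡ v (ψ , [ k ])
  v-cong refl = refl

  -- A closed formula has no occurrence for `ρ` to replace, so all its instances are the lifted
  -- formula itself.
  v-instantiate : ∀ (φ : Formula Θ) (h : Closed (lift φ)) ρ →
    v (instantiate 𝔄 φ ρ) ≡ v (lift φ , [ h ])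
  v-instantiate φ h ρ = v-cong (subst-id _ (lift φ) λ x p → contradiction p (h x))

  -- Undesignatedness of `φ` propagates outwards through the nested implication, turning a
  -- counterexample to consequence into one to the formula that the tableaux prove.
  v-foldr : ∀ (Γ : List (Formula Θ)) φ .(h : Closed (lift φ))
    .(k : Closed (lift (foldr _⇒_ φ Γ))) →
    (∀ γ → γ ∈ Γ → .(hγ : Closed (lift γ)) → v (lift γ , [ hγ ]) ∈ designated) →
    v (lift φ , [ h ]) ∈ 𝔽 ∷ 𝕗 ∷ [] →
    v (lift (foldr _⇒_ φ Γ) , [ k ]) ∈ 𝔽 ∷ 𝕗 ∷ []
  v-foldr []      φ h k des u = u
  v-foldr (γ ∷ Γ) φ h k des u =
    →̃-undesignated _ _ (des γ (here refl) (λ x p → k x (inj₁ p)))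
      (v-foldr Γ φ h (λ x p → k x (inj₂ p)) (λ γ′ p → des γ′ (there p)) u)
      (v-⇒ (lift γ) (lift (foldr _⇒_ φ Γ)) k)

  -- The image is demanded outright, not up to double negation, so that the clauses of the valuation
  -- can be applied to it. Being a `Sentence`, it also brings the closedness that signed formulas do
  -- not record.
  Holds : ConstRel → SignedFormula → Set
  Holds R (L ∶ φ) = Σ[ s ∈ Sentence (Θᵁ 𝔄) ] Related R φ (value s) × v s ≡ L

  Holds-update : ∀ {R c a σ} (B : Branch {Θ}) → c newOn B → σ ∈ formulas B →
                 Holds R σ → Holds (R ⟪ c ≔ a ⟫) σ
  Holds-update {σ = L ∶ φ} B new m (s , r , e) = s , Related-update (new L φ m) r , e

  Holds-prop : ∀ {R σ Δs} → PropRule σ Δs → Holds R σ → Any (All (Holds R)) Δs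
  Holds-prop {σ = _ ∶ neg _} rule ((neg φ , [ h ]) , neg r , refl) =
    neg-alternatives _ (_ , r , refl) (v-neg φ h) rule
  Holds-prop {σ = _ ∶ □ _} rule ((□ φ , [ h ]) , □ r , refl) =
    □-alternatives _ (_ , r , refl) (v-□ φ h) rule
  Holds-prop {σ = _ ∶ _ ⇒ _} rule ((φ ⇒ ψ , [ h ]) , r ⇒ r′ , refl) =
    ⇒-alternatives _ _ (_ , r , refl) (_ , r′ , refl) (v-⇒ φ ψ h) rule

  -- The minimum is taken over all constants of `Θᵁ`, hence also over `d`. The pair `R c d` is a
  -- hypothesis because totality yields it only under double negation.
  Holds-instance : ∀ {R L x φ c d} → Holds R (L ∶ all x φ) → R c d →
                   ∃[ a ] L ≤ᵛ a × Holds R (a ∶ φ [ x / con c ])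
  Holds-instance {x = x} ((all _ φ , [ h ]) , all _ r , refl) q =
    _ , least _ (_ , refl) , (_ , Related-[/] x r (con q) , refl)
    where
    least = proj₂ (v-all x φ h)

  -- `∀̃ᵈ₄` makes the minimum an attained value, so `c` can be sent to a constant attaining it. As
  -- `c` does not occur in `φ`, the image of `φ` stays the same.
  Holds-minimum : ∀ {R L x φ c} → Holds R (L ∶ all x φ) → ¬ (c occursIn φ) →
                  ∃[ d ] Holds (R ⟪ c ≔ d ⟫) (L ∶ φ [ x / con c ])
  Holds-minimum {x = x} ((all _ φ , [ h ]) , all _ r , refl) new with v-all x φ h
  ... | (d , e) , _ =
    d , (_ , Related-[/] x (Related-update new r) (con (inj₁ (refl , refl))) , e)

  -- Satisfiable branches and their preservation by rule steps

  record Satisfies (R : ConstRel) (B : Branch {Θ}) : Set where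
    field
      functional      : Functional R
      total           : ¬¬Total R
      formulas-hold   : All (Holds R) (formulas B)
      -- The reuse rules mention only a recorded witness; this invariant recovers the universal
      -- formula on the branch.
      witnesses-occur : ∀ {σ : SignedFormula {Θ}} {c} → (σ , c) ∈ witnesses B → σ ∈ formulas B

  open Satisfies

  Satisfiable : Branch {Θ} → Set₁
  Satisfiable B = ∃ λ R → Satisfies R B

  Satisfies-◂ : ∀ {R B Δ} → Satisfies R B → All (Holds R) Δ → Satisfies R (B ◂ Δ)
  Satisfies-◂ S hs = record
    { functional      = functional S
    ; total           = total S
    ; formulas-hold   = ++⁺ hs (formulas-hold S)
    ; witnesses-occur = λ m → ∈-++⁺ʳ _ (witnesses-occur S m)
    }

  -- Newness on the whole branch, not just in `σ`, lets every formula on it survive the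
  -- reinterpretation of `c`.
  Satisfies-witnessed : ∀ {R} {B : Branch {Θ}} {σ c a} → Satisfies R B →
                        σ ∈ formulas B → c newOn B →
                        Satisfies (R ⟪ c ≔ a ⟫) (witnessed B σ c)
  Satisfies-witnessed {R} {B} {c = c} S m new = record
    { functional      = update-functional {R} {c} (functional S)
    ; total           = update-total {R} {c} (total S)
    ; formulas-hold   =
        All.tabulate λ p → Holds-update B new p (All.lookup (formulas-hold S) p)
    ; witnesses-occur = λ { (here refl) → m ; (there p) → witnesses-occur S p }
    }

  -- `prop` and `F∀` yield a satisfiable successor directly. The other rules instantiate at a
  -- constant whose denotation `total` supplies only under double negation.
  step-sound : ∀ {B : Branch {Θ}} {Bs} → B ⟶ Bs → Satisfiable B → ¬ ¬ Any Satisfiable Bs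
  step-sound (prop m rule) (R , S) k =
    k (map⁺ (Any.map (λ hs → R , Satisfies-◂ S hs)
      (Holds-prop rule (All.lookup (formulas-hold S) m))))
  step-sound (T∀ c m) (R , S) k = total S c λ (d , q) →
    case Holds-instance (All.lookup (formulas-hold S) m) q of λ where
      (a , le , h) → case ≥𝕋 a le of λ where
        refl → k (here (R , Satisfies-◂ S (h ∷ [])))
  step-sound (F∀ c m _ new) (R , S) k =
    let d , h = Holds-minimum (All.lookup (formulas-hold S) m) (new _ _ m) in
    k (here (_ , Satisfies-◂ (Satisfies-witnessed S m new) (h ∷ [])))
  step-sound (t∀ c c′ m _ new _) (R , S) k =
    let d , h = Holds-minimum (All.lookup (formulas-hold S) m) (new _ _ m)
        S′    = Satisfies-witnessed S m new
    -- The denotation of `c′` is sought after the update, so that both instances hold under one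
    -- interpretation.
    in total S′ c′ λ (d′ , q) →
    case Holds-instance (All.lookup (formulas-hold S′) m) q of λ where
      (a , le , h′) → case ≥𝕥 a le of λ where
        (inj₁ refl) → k (here (_ , Satisfies-◂ S′ (h ∷ h′ ∷ [])))
        (inj₂ refl) → k (there (here (_ , Satisfies-◂ S′ (h ∷ h′ ∷ []))))
  step-sound (t∀-again c c′ w _) (R , S) k = total S c′ λ (d′ , q) →
    case Holds-instance (All.lookup (formulas-hold S) (witnesses-occur S w)) q of λ where
      (a , le , h) → case ≥𝕥 a le of λ where
        (inj₁ refl) → k (here (_ , Satisfies-◂ S (h ∷ [])))
        (inj₂ refl) → k (there (here (_ , Satisfies-◂ S (h ∷ []))))
  step-sound (f∀ c c′ m _ new _) (R , S) k =
    let d , h = Holds-minimum (All.lookup (formulas-hold S) m) (new _ _ m)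
        S′    = Satisfies-witnessed S m new
    in total S′ c′ λ (d′ , q) →
    case Holds-instance (All.lookup (formulas-hold S′) m) q of λ where
      (a , le , h′) → case ≥𝕗 a le of λ where
        (inj₁ refl)        → k (here (_ , Satisfies-◂ S′ (h ∷ h′ ∷ [])))
        (inj₂ (inj₁ refl)) → k (there (here (_ , Satisfies-◂ S′ (h ∷ h′ ∷ []))))
        (inj₂ (inj₂ refl)) → k (there (there (here (_ , Satisfies-◂ S′ (h ∷ h′ ∷ [])))))
  step-sound (f∀-again c c′ w _) (R , S) k = total S c′ λ (d′ , q) →
    case Holds-instance (All.lookup (formulas-hold S) (witnesses-occur S w)) q of λ where
      (a , le , h) → case ≥𝕗 a le of λ where
        (inj₁ refl)        → k (here (_ , Satisfies-◂ S (h ∷ [])))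
        (inj₂ (inj₁ refl)) → k (there (here (_ , Satisfies-◂ S (h ∷ []))))
        (inj₂ (inj₂ refl)) → k (there (there (here (_ , Satisfies-◂ S (h ∷ [])))))

  -- Refutation by closed tableaux

  closed-unsatisfiable : ∀ {B} → ClosedBranch B → ¬ Satisfiable B
  closed-unsatisfiable (L , L′ , φ , φ′ , m , m′ , φ∼φ′ , L≢L′) (R , S)
    with All.lookup (formulas-hold S) m | All.lookup (formulas-hold S) m′
  ... | (ψ , [ h ]) , r , refl | (ψ′ , [ h′ ]) , r′ , refl =
    -- Variance passes to the images, where the valuation cannot tell variants apart; the goal is
    -- absurdity, so the double negation is harmless.
    Related-∼ (functional S) (total S) φ∼φ′ r r′ λ ψ∼ψ′ → L≢L′ (v-∼ ψ ψ′ h h′ ψ∼ψ′)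

  -- Induction on the tableau. The conclusion is a negation and so absorbs the double negation of
  -- `step-sound`.
  tableau-sound  : ∀ {B} (t : Tableau B) → ClosedTableau t → ¬ Satisfiable B
  tableaux-sound : ∀ {Bs} (ts : All Tableau Bs) → All ClosedBranch (branchesˢ ts) →
                   ¬ Any Satisfiable Bs
  tableau-sound leaf           (cl ∷ []) sat = closed-unsatisfiable cl sat
  tableau-sound (extend st ts) cls       sat = step-sound st sat (tableaux-sound ts cls)
  tableaux-sound (t ∷ ts) cls (here sat)  = tableau-sound t (++⁻ˡ (branches t) cls) sat
  tableaux-sound (t ∷ ts) cls (there sat) = tableaux-sound ts (++⁻ʳ (branches t) cls) sat

  provable-sound : ∀ (φ : Formula Θ) .(h : Closed (lift φ)) (c₀ : Const (Θᵁ 𝔄)) → Provable φ →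
                   ¬ (v (lift φ , [ h ]) ∈ 𝔽 ∷ 𝕗 ∷ [])
  provable-sound φ h c₀ prf m =
    -- The actual value of `lift φ` selects the tableau, so the root signed formula holds by `refl`.
    let t , cl = prf _ m in tableau-sound t cl (_ , record
      { functional      = λ p q → trans p (sym q)
      ; total           = λ _ k → k (_ , refl)
      ; formulas-hold   = (_ , Related-lift R₀ (λ _ → refl) φ , refl) ∷ []
      ; witnesses-occur = λ ()
      })
    where
    R₀ : ConstRel
    -- Constants of `Θ` denote themselves. Those of `C̄` do not occur in the root and all get the
    -- default `c₀`; a rule that needs a particular denotation updates it.
    R₀ c d = d ≡ Sum.[ inj₁ , (λ _ → c₀) ] c

mainTheorem2 : (Θ : Signature) (Γ : List (Formula Θ)) (φ : Formula Θ) →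
    All Closed Γ → Closed φ → Γ ⊢ φ → Γ ⊨ φ
mainTheorem2 Θ Γ φ Γ-closed φ-closed prf 𝔄 V des ρ = conclusion
  where
  open Valuation V
  φ-closed′ = closed-lift φ φ-closed

  Γ⇒φ-closed = closed-lift (foldr _⇒_ φ Γ) (closed-foldr Γ φ Γ-closed φ-closed)

  des′ : ∀ γ → γ ∈ Γ → .(h : Closed (lift γ)) → v (lift γ , [ h ]) ∈ designated
  des′ γ m h =
    ≡-subst (_∈ designated)
      (v-instantiate V γ (closed-lift γ (All.lookup Γ-closed m)) ρ) (des γ m ρ)

  conclusion : v (instantiate 𝔄 φ ρ) ∈ designated
  -- Values are decidably designated, so refuting the other case gives the positive conclusion
  -- although soundness is a negative statement.
  conclusion with designated-or-not (v (lift φ , [ φ-closed′ ]))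
  ... | inj₁ d = ≡-subst (_∈ designated) (sym (v-instantiate V φ φ-closed′ ρ)) d
  ... | inj₂ u = contradiction (v-foldr V Γ φ φ-closed′ Γ⇒φ-closed des′ u)
                   -- Any constant of `Θᵁ` serves as default, and `ρ` provides one. Taking it from
                   -- `point` would require deciding whether a constant of `Θ` denotes that element.
                   (provable-sound V (foldr _⇒_ φ Γ) Γ⇒φ-closed (ρ 0) prf)
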